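{- Let $\Sigma$ be a finite alphabet and let $\mathbf{w}:\mathbb{Z}^2\to\Sigma$ be a multi-scale coverable infinite picture. Then $\mathbf{w}$ has uniform frequencies; that is, for every block $u$ of $\mathbf{w}$ the limit $f_u(\mathbf{w})=\lim_{n\to\infty} f_u(B_n(\mathbf{w}))$ exists.
   Context: An infinite picture ($\mathbb{Z}^2$-word) is a total function $\mathbf{w}:\mathbb{Z}^2\to\Sigma$. A block (finite picture) of size $k\times\ell$ is a word indexed by a rectangle of width $k$ and height $\ell$ (considered up to translation); a block of $\mathbf{w}$ is one that occurs in $\mathbf{w}$ as the restriction of $\mathbf{w}$ to a rectangle. A block $q$ is a cover of $\mathbf{w}$ if every position of $\mathbb{Z}^2$ belongs to some occurrence of $q$ in $\mathbf{w}$. The picture $\mathbf{w}$ is multi-scale coverable if for each $n\in\mathbb{N}$ it has a cover of size $k\times\ell$ with both $k\ge n$ and $\ell\ge n$. For finite blocks $u,v$, $|v|=\mathrm{width}(v)\cdot\mathrm{height}(v)$, $|v|_u$ is the number of occurrences of $u$ in $v$, and $f_u(v)=|v|_u/|v|$. $B_n(\mathbf{w})$ is the restriction of $\mathbf{w}$ to $\{ -n,\dots,n\}\times\{ -n,\dots,n\}$. -}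

module Defs where

open import Data.Fin.Base using (Fin; toℕ; inject≤; _↑ʳ_)
import Data.Fin.Properties as Fin
open import Data.Integer.Base as ℤ using (ℤ; +_; -_)
open import Data.List.Base using (cartesianProduct; filter; length; upTo)
open import Data.Nat.Base as ℕ using (ℕ; suc; NonZero)
import Data.Nat.Properties as ℕ
open import Data.Product.Base using (Σ-syntax; ∃-syntax; _×_; _,_)
open import Data.Rational.Base as ℚ using (ℚ; 0ℚ; _/_; ∣_∣)
open import Relation.Binary.PropositionalEquality using (_≗_)
open import Relation.Nullary.Decidable using (Dec; yes; no; map′)

-- The alphabet with s letters is Fin s.

Picture : ℕ → Set
Picture s = ℤ × ℤ → Fin s

-- Blocks are compared pointwise (_≗_), as functions are not extensional.
Block : ℕ → ℕ → ℕ → Set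
Block s k ℓ = Fin k × Fin ℓ → Fin s

private
  variable
    s a b k ℓ : ℕ

-- The first coordinate is horizontal, and (x , y) is the corner of the
-- rectangle with the smallest coordinates.
restrict : Picture s → ℤ × ℤ → (k ℓ : ℕ) → Block s k ℓ
restrict w (x , y) k ℓ (i , j) = w (x ℤ.+ + toℕ i , y ℤ.+ + toℕ j)

OccursAt : Block s k ℓ → Picture s → ℤ × ℤ → Set
OccursAt {k = k} {ℓ = ℓ} q w p = q ≗ restrict w p k ℓ

IsBlockOf : Block s k ℓ → Picture s → Set
IsBlockOf q w = ∃[ p ] OccursAt q w p

InRectangle : ℤ × ℤ → ℕ → ℕ → ℤ × ℤ → Set
InRectangle (x , y) k ℓ (x′ , y′) =
  (x ℤ.≤ x′ × x′ ℤ.< x ℤ.+ + k) × (y ℤ.≤ y′ × y′ ℤ.< y ℤ.+ + ℓ)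

IsCover : Block s k ℓ → Picture s → Set
IsCover {k = k} {ℓ = ℓ} q w =
  ∀ p → ∃[ c ] (OccursAt q w c × InRectangle c k ℓ p)

MultiScaleCoverable : Picture s → Set
MultiScaleCoverable {s} w =
  ∀ n → ∃[ k ] ∃[ ℓ ] (k ℕ.≥ n × ℓ ℕ.≥ n × Σ[ q ∈ Block s k ℓ ] IsCover q w)

subBlock : Block s k ℓ → (i j : ℕ) → i ℕ.+ a ℕ.≤ k → j ℕ.+ b ℕ.≤ ℓ → Block s a b
subBlock v i j i+a≤k j+b≤ℓ (x , y) =
  v (inject≤ (i ↑ʳ x) i+a≤k , inject≤ (j ↑ʳ y) j+b≤ℓ)

OccursInAt : Block s a b → Block s k ℓ → ℕ × ℕ → Set
OccursInAt {a = a} {b = b} {k = k} {ℓ = ℓ} u v (i , j) =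
  Σ[ i+a≤k ∈ i ℕ.+ a ℕ.≤ k ] Σ[ j+b≤ℓ ∈ j ℕ.+ b ℕ.≤ ℓ ]
    (u ≗ subBlock v i j i+a≤k j+b≤ℓ)

_≗?_ : (u v : Block s a b) → Dec (u ≗ v)
u ≗? v = map′ (λ f (x , y) → f x y) (λ f x y → f (x , y))
  (Fin.all? λ x → Fin.all? λ y → u (x , y) Fin.≟ v (x , y))

occursInAt? : (u : Block s a b) (v : Block s k ℓ) → ∀ p → Dec (OccursInAt u v p)
occursInAt? {a = a} {b = b} {k = k} {ℓ = ℓ} u v (i , j)
  with i ℕ.+ a ℕ.≤? k | j ℕ.+ b ℕ.≤? ℓ
... | no ¬p | _     = no λ (p , _) → ¬p p
... | yes _ | no ¬q = no λ (_ , q , _) → ¬q q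
... | yes p | yes q =
  map′ (λ e → p , q , e) (λ (_ , _ , e) → e) (u ≗? subBlock v i j p q)

-- Every occurrence has its corner (i , j) with i ≤ k and j ≤ ℓ.
occurrences : Block s a b → Block s k ℓ → ℕ
occurrences {k = k} {ℓ = ℓ} u v =
  length (filter (occursInAt? u v) (cartesianProduct (upTo (suc k)) (upTo (suc ℓ))))

frequency : Block s a b → Block s k ℓ → .{{NonZero k}} → .{{NonZero ℓ}} → ℚ
frequency {k = k} {ℓ = ℓ} u v = (+ occurrences u v / (k ℕ.* ℓ)) {{ℕ.m*n≢0 k ℓ}}

centralBlock : (n : ℕ) → Picture s → Block s (suc (2 ℕ.* n)) (suc (2 ℕ.* n))
centralBlock n w = restrict w (- + n , - + n) _ _

-- Bishop's reals: regular sequences of rationals.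
record ℝ : Set where
  field
    approx  : ℕ → ℚ
    regular : ∀ m n →
      ∣ approx m ℚ.- approx n ∣ ℚ.≤ (+ 1 / suc m) ℚ.+ (+ 1 / suc n)

open ℝ public

-- ∣ p - x ∣ ≤ ε in ℝ: regularity puts x within 1/(m+1) of its m-th
-- approximation.
Within : ℚ → ℚ → ℝ → Set
Within ε p x = ∀ m → ∣ p ℚ.- approx x m ∣ ℚ.≤ ε ℚ.+ (+ 1 / suc m)

ConvergesTo : (ℕ → ℚ) → ℝ → Set
ConvergesTo f x =
  ∀ ε → 0ℚ ℚ.< ε → ∃[ N ] (∀ n → n ℕ.≥ N → Within ε (f n) x)

HasUniformFrequencies : Picture s → Set
HasUniformFrequencies {s} w =
  ∀ {a b} (u : Block s a b) → IsBlockOf u w →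
  Σ[ x ∈ ℝ ] ConvergesTo (λ n → frequency u (centralBlock n w)) x

{-# OPTIONS --safe #-}
module Submission where

-- Suppose that on large rectangles the density of u lies between α and β.
-- If q is a large cover, the occurrence of q through the centre of a cell
-- three times as large as q lies in that cell, so that every cell contains,
-- on a fixed proportion of its area, the same number of occurrences of u.
-- If the density of u in q is at least (α + β) / 2, this raises the lower
-- bound α on all cells, hence on all large rectangles; otherwise it lowers
-- the upper bound β. Either way β - α shrinks by a constant factor, so the
-- frequencies form a Cauchy sequence, with an explicit modulus. Upper bounds
-- are treated as lower bounds for the complement of the occurrences of u.

open import Defs
open import Algebra.Properties.Group using (//-rightDividesʳ; ⁻¹-anti-homo-//)
open import Data.Bool.Base using (true; false; if_then_else_)
open import Data.Empty using (⊥; ⊥-elim)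
open import Data.Fin.Base using (toℕ; inject≤; _↑ʳ_)
import Data.Fin.Properties as Fin
open import Data.Integer.Base as ℤ using (ℤ; +_)
import Data.Integer.Properties as ℤ
open import Data.List.Base using (_++_; applyUpTo; cartesianProduct; filter; length; map)
open import Data.List.Properties using (filter-++; length-++)
open import Data.Nat.Base
open import Data.Nat.DivMod using (m≡m%n+[m/n]*n; m%n<n)
open import Data.Nat.Properties
open import Data.Nat.Tactic.RingSolver using (solve-∀)
open import Data.Product.Base using (Σ-syntax; ∃-syntax; _×_; _,_; proj₁; proj₂)
open import Data.Rational.Base as ℚ using (ℚ)
import Data.Rational.Properties as ℚ
open import Data.Rational.Unnormalised.Base as ℚᵘ using (mkℚᵘ)
import Data.Rational.Unnormalised.Properties as ℚᵘ
open import Data.Sum.Base using (_⊎_; inj₁; inj₂)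
open import Function.Base using (_∘_)
open import Function.Bundles using (_⇔_; mk⇔)
open import Relation.Binary.PropositionalEquality
  using (_≡_; _≗_; refl; sym; trans; cong; cong₂; subst; subst₂; module ≡-Reasoning)
open import Relation.Nullary.Decidable using (Dec; _because_; does; does-⇔; dec-false)
open import Relation.Unary using (Pred; Decidable)

-- Counting in rectangles

+-assoc-pos : ∀ x m n → (x ℤ.+ + m) ℤ.+ + n ≡ x ℤ.+ + (m + n)
+-assoc-pos x m n = trans (ℤ.+-assoc x (+ m) (+ n)) (cong (λ i → x ℤ.+ i) (sym (ℤ.pos-+ m n)))

sumBelow : (ℕ → ℕ) → ℕ → ℕ
sumBelow h zero    = 0
sumBelow h (suc n) = h 0 + sumBelow (λ i → h (suc i)) n

sumBelow-cong : ∀ {h g : ℕ → ℕ} n → (∀ i → i < n → h i ≡ g i) → sumBelow h n ≡ sumBelow g n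
sumBelow-cong zero    e = refl
sumBelow-cong (suc n) e =
  cong₂ _+_ (e 0 z<s) (sumBelow-cong n (λ i i<n → e (suc i) (s<s i<n)))

sumBelow-const : ∀ c n → sumBelow (λ _ → c) n ≡ n * c
sumBelow-const c zero    = refl
sumBelow-const c (suc n) = cong (λ s → c + s) (sumBelow-const c n)

sumBelow-split : ∀ h m n → sumBelow h (m + n) ≡ sumBelow h m + sumBelow (λ i → h (m + i)) n
sumBelow-split h zero    n = refl
sumBelow-split h (suc m) n = trans
  (cong (λ s → h 0 + s) (sumBelow-split (λ i → h (suc i)) m n)) (sym (+-assoc (h 0) _ _))

interchange : ∀ a b c d → (a + b) + (c + d) ≡ (a + c) + (b + d)
interchange = solve-∀

sumBelow-+ : ∀ h g n → sumBelow (λ i → h i + g i) n ≡ sumBelow h n + sumBelow g n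
sumBelow-+ h g zero    = refl
sumBelow-+ h g (suc n) = trans
  (cong (λ s → h 0 + g 0 + s) (sumBelow-+ (λ i → h (suc i)) (λ i → g (suc i)) n))
  (interchange (h 0) (g 0) _ _)

sumBelow-zero : ∀ {h} n → (∀ i → h i ≡ 0) → sumBelow h n ≡ 0
sumBelow-zero n h≡0 = trans (sumBelow-cong n (λ i _ → h≡0 i))
  (trans (sumBelow-const 0 n) (*-zeroʳ n))

sumBelow-truncate : ∀ h m n → (∀ i → h (m + i) ≡ 0) → sumBelow h (m + n) ≡ sumBelow h m
sumBelow-truncate h m n h≡0 = trans (sumBelow-split h m n)
  (trans (cong (λ z → sumBelow h m + z) (sumBelow-zero n h≡0)) (+-identityʳ _))

Weight : Set
Weight = ℤ → ℤ → ℕ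

count : Weight → ℤ → ℤ → ℕ → ℕ → ℕ
count f x y K L = sumBelow (λ i → sumBelow (λ j → f (x ℤ.+ + i) (y ℤ.+ + j)) L) K

count-splitˣ : ∀ f x y K K′ L →
  count f x y (K + K′) L ≡ count f x y K L + count f (x ℤ.+ + K) y K′ L
count-splitˣ f x y K K′ L = trans (sumBelow-split _ K K′)
  (cong (λ s → count f x y K L + s) (sumBelow-cong K′ λ i _ → sumBelow-cong L λ j _ →
    cong (λ z → f z (y ℤ.+ + j)) (sym (+-assoc-pos x K i))))

count-splitʸ : ∀ f x y K L L′ →
  count f x y K (L + L′) ≡ count f x y K L + count f x (y ℤ.+ + L) K L′
count-splitʸ f x y K L L′ = trans
  (sumBelow-cong K λ i _ → trans (sumBelow-split _ L L′)
    (cong (λ s → sumBelow (λ j → f (x ℤ.+ + i) (y ℤ.+ + j)) L + s)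
      (sumBelow-cong L′ λ j _ → cong (f (x ℤ.+ + i)) (sym (+-assoc-pos y L j)))))
  (sumBelow-+ _ _ K)

Complementary : Weight → Weight → Set
Complementary f g = ∀ x y → f x y + g x y ≡ 1

count-complement : ∀ {f g} → Complementary f g →
  ∀ x y K L → count f x y K L + count g x y K L ≡ K * L
count-complement f+g≡1 x y K L = trans (sym (sumBelow-+ _ _ K))
  (trans (sumBelow-cong K λ i _ → trans (sym (sumBelow-+ _ _ L))
    (trans (sumBelow-cong L λ j _ → f+g≡1 _ _) (trans (sumBelow-const 1 L) (*-identityʳ L))))
  (sumBelow-const L K))

count-mono : ∀ f x y K K′ L L′ → count f x y K L ≤ count f x y (K + K′) (L + L′)
count-mono f x y K K′ L L′ = begin
  count f x y K L                ≤⟨ m≤m+n _ _ ⟩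
  count f x y K L + _            ≡⟨ count-splitʸ f x y K L L′ ⟨
  count f x y K (L + L′)         ≤⟨ m≤m+n _ _ ⟩
  count f x y K (L + L′) + _     ≡⟨ count-splitˣ f x y K K′ (L + L′) ⟨
  count f x y (K + K′) (L + L′)  ∎
  where open ≤-Reasoning

-- Squeezing the density

-- The density of f is at least A / D, up to an error proportional to the
-- perimeter, which makes the bound meaningful for thin rectangles too.
DensityAtLeast : Weight → ℕ → ℕ → ℕ → Set
DensityAtLeast f A D N = ∀ x y K L → A * (K * L) ≤ D * (count f x y K L + N * (K + L))

densityAtLeast-scale : ∀ {f A D N} c → DensityAtLeast f A D N → DensityAtLeast f (c * A) (c * D) N
densityAtLeast-scale {f} {A} {D} {N} c low x y K L = begin
  c * A * (K * L)                            ≡⟨ *-assoc c A _ ⟩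
  c * (A * (K * L))                          ≤⟨ *-monoʳ-≤ c (low x y K L) ⟩
  c * (D * (count f x y K L + N * (K + L)))  ≡⟨ *-assoc c D _ ⟨
  c * D * (count f x y K L + N * (K + L))    ∎
  where open ≤-Reasoning

densityAtLeast-mono : ∀ {f A D N N′} → N ≤ N′ → DensityAtLeast f A D N → DensityAtLeast f A D N′
densityAtLeast-mono {f} {A} {D} {N} {N′} N≤N′ low x y K L = begin
  A * (K * L)
    ≤⟨ low x y K L ⟩
  D * (count f x y K L + N * (K + L))
    ≤⟨ *-monoʳ-≤ D (+-monoʳ-≤ (count f x y K L) (*-monoˡ-≤ (K + L) N≤N′)) ⟩
  D * (count f x y K L + N′ * (K + L)) ∎
  where open ≤-Reasoning

tile-rowˣ : ∀ {f B D P R} → (∀ x y → B ≤ D * count f x y P R) →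
  ∀ s x y → s * B ≤ D * count f x y (s * P) R
tile-rowˣ tile zero    x y = z≤n
tile-rowˣ {f} {B} {D} {P} {R} tile (suc s) x y = begin
  B + s * B
    ≤⟨ +-mono-≤ (tile x y) (tile-rowˣ {f} {B} {D} {P} {R} tile s (x ℤ.+ + P) y) ⟩
  D * count f x y P R + D * count f (x ℤ.+ + P) y (s * P) R
    ≡⟨ *-distribˡ-+ D _ _ ⟨
  D * (count f x y P R + count f (x ℤ.+ + P) y (s * P) R)
    ≡⟨ cong (D *_) (count-splitˣ f x y P (s * P) R) ⟨
  D * count f x y (suc s * P) R ∎
  where open ≤-Reasoning

tile-rowʸ : ∀ {f B D P R} → (∀ x y → B ≤ D * count f x y P R) →
  ∀ s x y → s * B ≤ D * count f x y P (s * R)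
tile-rowʸ tile zero    x y = z≤n
tile-rowʸ {f} {B} {D} {P} {R} tile (suc s) x y = begin
  B + s * B
    ≤⟨ +-mono-≤ (tile x y) (tile-rowʸ {f} {B} {D} {P} {R} tile s x (y ℤ.+ + R)) ⟩
  D * count f x y P R + D * count f x (y ℤ.+ + R) P (s * R)
    ≡⟨ *-distribˡ-+ D _ _ ⟨
  D * (count f x y P R + count f x (y ℤ.+ + R) P (s * R))
    ≡⟨ cong (D *_) (count-splitʸ f x y P R (s * R)) ⟨
  D * count f x y P (suc s * R) ∎
  where open ≤-Reasoning

-- Copies of the cell fill the rectangle from its corner, except for a strip narrower than `P` and
-- one lower than `R`. Their total area is at most `P * L + R * K`, and since `A ≤ D` the error term
-- pays for it.
densityAtLeast-tile : ∀ {f A D P R} .{{_ : NonZero P}} .{{_ : NonZero R}} → A ≤ D →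
  (∀ x y → A * (P * R) ≤ D * count f x y P R) → DensityAtLeast f A D (P + R)
densityAtLeast-tile {f} {A} {D} {P} {R} A≤D tile x y K L = begin
  A * (K * L)
    ≡⟨ cong₂ (λ k l → A * (k * l)) K≡ L≡ ⟩
  A * ((p + s * P) * (r + t * R))
    ≡⟨ expand A p (s * P) r t R ⟩
  A * (p * (r + t * R)) + (A * ((s * P) * r) + t * (A * (s * P * R)))
    ≡⟨ cong (λ z → A * (p * (r + t * R)) + (A * ((s * P) * r) + t * z)) (shift A s P R) ⟩
  A * (p * (r + t * R)) + (A * ((s * P) * r) + t * (s * (A * (P * R))))
    ≤⟨ +-mono-≤ (*-mono-≤ A≤D (*-mono-≤ p≤P (≤-reflexive (sym L≡))))
        (+-mono-≤ (*-mono-≤ A≤D (*-mono-≤ sP≤K r≤R))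
          (≤-trans (tile-rowʸ {f} {D = D} {s * P} {R} (tile-rowˣ {f} {D = D} {P} {R} tile s) t x y)
            (*-monoʳ-≤ D count≤))) ⟩
  D * (P * L) + (D * (K * R) + D * count f x y K L)
    ≡⟨ collect D P L K R (count f x y K L) ⟩
  D * (count f x y K L + (P * L + R * K))
    ≤⟨ *-monoʳ-≤ D (+-monoʳ-≤ (count f x y K L) (m≤m+n _ (P * K + R * L))) ⟩
  D * (count f x y K L + ((P * L + R * K) + (P * K + R * L)))
    ≡⟨ cong (λ z → D * (count f x y K L + z)) (perimeter P L R K) ⟩
  D * (count f x y K L + (P + R) * (K + L)) ∎
  where
  open ≤-Reasoning
  p = K % P
  s = K / P
  r = L % R
  t = L / R
  K≡ : K ≡ p + s * P
  K≡ = m≡m%n+[m/n]*n K P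
  L≡ : L ≡ r + t * R
  L≡ = m≡m%n+[m/n]*n L R
  p≤P : p ≤ P
  p≤P = <⇒≤ (m%n<n K P)
  r≤R : r ≤ R
  r≤R = <⇒≤ (m%n<n L R)
  sP≤K : s * P ≤ K
  sP≤K = ≤-trans (m≤n+m (s * P) p) (≤-reflexive (sym K≡))
  count≤ : count f x y (s * P) (t * R) ≤ count f x y K L
  count≤ = ≤-trans (count-mono f x y (s * P) p (t * R) r)
    (≤-reflexive (cong₂ (count f x y) (trans (+-comm (s * P) p) (sym K≡))
                                      (trans (+-comm (t * R) r) (sym L≡))))
  expand : ∀ A p S r t R → A * ((p + S) * (r + t * R)) ≡
    A * (p * (r + t * R)) + (A * (S * r) + t * (A * (S * R)))
  expand = solve-∀
  shift : ∀ A s P R → A * (s * P * R) ≡ s * (A * (P * R))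
  shift = solve-∀
  collect : ∀ D P L K R C → D * (P * L) + (D * (K * R) + D * C) ≡ D * (C + (P * L + R * K))
  collect = solve-∀
  perimeter : ∀ P L R K → (P * L + R * K) + (P * K + R * L) ≡ (P + R) * (K + L)
  perimeter = solve-∀

-- Since i + i′ ≡ 2 * k, a cell of width 3 * k splits into strips of widths
-- i , k and i′; likewise for the heights.
Recurs : Weight → ℕ → ℕ → ℕ → Set
Recurs f k ℓ m = ∀ x y → ∃[ i ] ∃[ i′ ] ∃[ j ] ∃[ j′ ]
  (i + i′ ≡ 2 * k × j + j′ ≡ 2 * ℓ × count f (x ℤ.+ + i) (y ℤ.+ + j) k ℓ ≡ m)

count-around : ∀ f x y i k i′ j ℓ j′ →
  let x₁ = x ℤ.+ + i; x₂ = x₁ ℤ.+ + k; y₁ = y ℤ.+ + j; y₂ = y₁ ℤ.+ + ℓ; L = j + (ℓ + j′) in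
  count f x y (i + (k + i′)) L ≡
    count f x y i L +
      ((count f x₁ y k j + (count f x₁ y₁ k ℓ + count f x₁ y₂ k j′)) + count f x₂ y i′ L)
count-around f x y i k i′ j ℓ j′ = begin
  count f x y (i + (k + i′)) L
    ≡⟨ count-splitˣ f x y i (k + i′) L ⟩
  c₁ + count f x₁ y (k + i′) L
    ≡⟨ cong (λ c → c₁ + c) (count-splitˣ f x₁ y k i′ L) ⟩
  c₁ + (count f x₁ y k L + c₄)
    ≡⟨ cong (λ c → c₁ + (c + c₄)) (count-splitʸ f x₁ y k j (ℓ + j′)) ⟩
  c₁ + ((c₂ + count f x₁ y₁ k (ℓ + j′)) + c₄)
    ≡⟨ cong (λ c → c₁ + ((c₂ + c) + c₄)) (count-splitʸ f x₁ y₁ k ℓ j′) ⟩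
  c₁ + ((c₂ + (count f x₁ y₁ k ℓ + count f x₁ (y₁ ℤ.+ + ℓ) k j′)) + c₄) ∎
  where
  open ≡-Reasoning
  x₁ = x ℤ.+ + i
  y₁ = y ℤ.+ + j
  L  = j + (ℓ + j′)
  c₁ = count f x y i L
  c₂ = count f x₁ y k j
  c₄ = count f (x₁ ℤ.+ + k) y i′ L

-- The frame around the recurring block consists of four rectangles, each subject to the density
-- bound, while the block contributes exactly `m`. Neither the area `8 * (k * ℓ)` of the frame nor
-- the sum `4 * k + 8 * ℓ` of the half-perimeters depends on where in the cell the block lies.
count-cell : ∀ {f A D N k ℓ m} → DensityAtLeast f A D N → Recurs f k ℓ m → ∀ x y →
  A * (8 * (k * ℓ)) + D * m ≤ D * (count f x y (3 * k) (3 * ℓ) + N * (4 * k + 8 * ℓ))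
count-cell {f} {A} {D} {N} {k} {ℓ} {m} low rec x y with rec x y
... | i , i′ , j , j′ , i+i′ , j+j′ , refl = begin
  A * (8 * (k * ℓ)) + D * m
    ≡⟨ cong (λ z → A * z + D * m) area ⟨
  A * (((i + i′) * L) + k * (j + j′)) + D * m
    ≡⟨ expand A i i′ L k j j′ (D * m) ⟩
  A * (i * L) + (A * (k * j) + (A * (k * j′) + (A * (i′ * L) + D * m)))
    ≤⟨ +-mono-≤ (low x y i L) (+-mono-≤ (low x₁ y k j) (+-mono-≤ (low x₁ y₂ k j′)
        (+-monoˡ-≤ (D * m) (low x₂ y i′ L)))) ⟩
  D * (c₁ + N * (i + L)) + (D * (c₂ + N * (k + j)) + (D * (c₃ + N * (k + j′)) +
    (D * (c₄ + N * (i′ + L)) + D * m)))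
    ≡⟨ collect D N c₁ c₂ c₃ c₄ m i i′ L k j j′ ⟩
  D * ((c₁ + ((c₂ + (m + c₃)) + c₄)) + N * ((i + i′) + (j + j′) + 2 * L + 2 * k))
    ≡⟨ cong (λ z → D * (z + N * ((i + i′) + (j + j′) + 2 * L + 2 * k)))
         (count-around f x y i k i′ j ℓ j′) ⟨
  D * (count f x y (i + (k + i′)) L + N * ((i + i′) + (j + j′) + 2 * L + 2 * k))
    ≡⟨ cong₂ (λ z h → D * (z + N * h))
         (cong₂ (count f x y) (side i k i′ i+i′) (side j ℓ j′ j+j′)) half ⟩
  D * (count f x y (3 * k) (3 * ℓ) + N * (4 * k + 8 * ℓ)) ∎
  where
  open ≤-Reasoning
  L  = j + (ℓ + j′)
  x₁ = x ℤ.+ + i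
  x₂ = x₁ ℤ.+ + k
  y₂ = y ℤ.+ + j ℤ.+ + ℓ
  c₁ = count f x y i L
  c₂ = count f x₁ y k j
  c₃ = count f x₁ y₂ k j′
  c₄ = count f x₂ y i′ L
  regroup : ∀ i k i′ → i + (k + i′) ≡ k + (i + i′)
  regroup = solve-∀
  side : ∀ i k i′ → i + i′ ≡ 2 * k → i + (k + i′) ≡ 3 * k
  side i k i′ e = trans (regroup i k i′) (cong (λ z → k + z) e)
  area′ : ∀ k ℓ → 2 * k * (3 * ℓ) + k * (2 * ℓ) ≡ 8 * (k * ℓ)
  area′ = solve-∀
  area : (i + i′) * L + k * (j + j′) ≡ 8 * (k * ℓ)
  area = trans (cong₂ _+_ (cong₂ _*_ i+i′ (side j ℓ j′ j+j′)) (cong (k *_) j+j′)) (area′ k ℓ)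
  half′ : ∀ k ℓ → 2 * k + 2 * ℓ + 2 * (3 * ℓ) + 2 * k ≡ 4 * k + 8 * ℓ
  half′ = solve-∀
  half : (i + i′) + (j + j′) + 2 * L + 2 * k ≡ 4 * k + 8 * ℓ
  half = trans (cong₂ (λ z L → z + 2 * L + 2 * k) (cong₂ _+_ i+i′ j+j′) (side j ℓ j′ j+j′))
    (half′ k ℓ)
  expand : ∀ A i i′ L k j j′ M → A * (((i + i′) * L) + k * (j + j′)) + M ≡
    A * (i * L) + (A * (k * j) + (A * (k * j′) + (A * (i′ * L) + M)))
  expand = solve-∀
  collect : ∀ D N c₁ c₂ c₃ c₄ m i i′ L k j j′ →
    D * (c₁ + N * (i + L)) + (D * (c₂ + N * (k + j)) + (D * (c₃ + N * (k + j′)) +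
    (D * (c₄ + N * (i′ + L)) + D * m))) ≡
    D * ((c₁ + ((c₂ + (m + c₃)) + c₄)) + N * ((i + i′) + (j + j′) + 2 * L + 2 * k))
  collect = solve-∀

-- A recurring block of density at least A / D + E / 2D occupies a ninth of
-- a cell, which raises the lower bound by E / 36D.
densityAtLeast-improve : ∀ {f A D E N k ℓ m} .{{_ : NonZero k}} .{{_ : NonZero ℓ}} →
  1 ≤ E → A + E ≤ D →
  64 * (D * N) ≤ k → 64 * (D * N) ≤ ℓ →
  DensityAtLeast f A D N → Recurs f k ℓ m → (2 * A + E) * (k * ℓ) ≤ 2 * (D * m) →
  DensityAtLeast f (36 * A + E) (36 * D) (3 * k + 3 * ℓ)
densityAtLeast-improve {f} {A} {D} {E} {N} {k} {ℓ} {m} 1≤E A+E≤D n≤k n≤ℓ low rec large =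
  densityAtLeast-tile {f} {P = 3 * k} {R = 3 * ℓ} {{m*n≢0 3 k}} {{m*n≢0 3 ℓ}} bound tile
  where
  open ≤-Reasoning
  bound : 36 * A + E ≤ 36 * D
  bound = ≤-trans (+-monoʳ-≤ (36 * A) (m≤n*m E 36))
    (≤-trans (≤-reflexive (sym (*-distribˡ-+ 36 A E))) (*-monoʳ-≤ 36 A+E≤D))
  error′ : ∀ D N k ℓ → 2 * (4 * (D * (N * (4 * k + 8 * ℓ)))) ≡ 32 * (D * N) * k + 64 * (D * N) * ℓ
  error′ = solve-∀
  double : ∀ k ℓ → ℓ * k + k * ℓ ≡ 2 * (k * ℓ)
  double = solve-∀
  -- The recurring block brings a surplus of half of `E * (k * ℓ)`. The size of `k` and `ℓ` limits
  -- the perimeter error to half of this surplus; the remaining quarter of `E * (k * ℓ)`, spread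
  -- over a cell of area `9 * (k * ℓ)`, is the gain of `E / 36`.
  error : 4 * (D * (N * (4 * k + 8 * ℓ))) ≤ E * (k * ℓ)
  error = *-cancelˡ-≤ 2 (begin
    2 * (4 * (D * (N * (4 * k + 8 * ℓ))))
      ≡⟨ error′ D N k ℓ ⟩
    32 * (D * N) * k + 64 * (D * N) * ℓ
      ≤⟨ +-mono-≤ (*-monoˡ-≤ k (≤-trans (*-monoˡ-≤ (D * N) (m≤m+n 32 32)) n≤ℓ)) (*-monoˡ-≤ ℓ n≤k) ⟩
    ℓ * k + k * ℓ
      ≡⟨ double k ℓ ⟩
    2 * (k * ℓ)
      ≤⟨ *-monoʳ-≤ 2 (≤-trans (≤-reflexive (sym (*-identityˡ _))) (*-monoˡ-≤ (k * ℓ) 1≤E)) ⟩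
    2 * (E * (k * ℓ)) ∎)
  tile₁ : ∀ A E X → (36 * A + E) * (9 * X) + 9 * (E * X) ≡ 9 * (32 * (A * X) + 2 * ((2 * A + E) * X))
  tile₁ = solve-∀
  tile₂ : ∀ A X M → 9 * (32 * (A * X) + 2 * (2 * M)) ≡ 36 * (A * (8 * X) + M)
  tile₂ = solve-∀
  tile₃ : ∀ D C H → 36 * (D * (C + H)) ≡ 36 * D * C + 9 * (4 * (D * H))
  tile₃ = solve-∀
  nine : ∀ k ℓ → 3 * k * (3 * ℓ) ≡ 9 * (k * ℓ)
  nine = solve-∀
  tile : ∀ x y → (36 * A + E) * (3 * k * (3 * ℓ)) ≤ 36 * D * count f x y (3 * k) (3 * ℓ)
  tile x y = +-cancelʳ-≤ (9 * (E * (k * ℓ))) _ _ (begin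
    (36 * A + E) * (3 * k * (3 * ℓ)) + 9 * (E * (k * ℓ))
      ≡⟨ cong (λ z → (36 * A + E) * z + 9 * (E * (k * ℓ))) (nine k ℓ) ⟩
    (36 * A + E) * (9 * (k * ℓ)) + 9 * (E * (k * ℓ))
      ≡⟨ tile₁ A E (k * ℓ) ⟩
    9 * (32 * (A * (k * ℓ)) + 2 * ((2 * A + E) * (k * ℓ)))
      ≤⟨ *-monoʳ-≤ 9 (+-monoʳ-≤ (32 * (A * (k * ℓ))) (*-monoʳ-≤ 2 large)) ⟩
    9 * (32 * (A * (k * ℓ)) + 2 * (2 * (D * m)))
      ≡⟨ tile₂ A (k * ℓ) (D * m) ⟩
    36 * (A * (8 * (k * ℓ)) + D * m)
      ≤⟨ *-monoʳ-≤ 36 (count-cell {f} {A} {D} {N} {k} {ℓ} low rec x y) ⟩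
    36 * (D * (C + N * (4 * k + 8 * ℓ)))
      ≡⟨ tile₃ D C (N * (4 * k + 8 * ℓ)) ⟩
    36 * D * C + 9 * (4 * (D * (N * (4 * k + 8 * ℓ))))
      ≤⟨ +-monoʳ-≤ (36 * D * C) (*-monoʳ-≤ 9 error) ⟩
    36 * D * C + 9 * (E * (k * ℓ)) ∎)
    where C = count f x y (3 * k) (3 * ℓ)

Recurrent : Weight → Set
Recurrent f = ∀ n → ∃[ k ] ∃[ ℓ ] ∃[ m ] (n ≤ k × n ≤ ℓ × Recurs f k ℓ m)

-- With g complementary to f, the density of f on large rectangles lies
-- essentially between A / D and 1 - G / D, an interval of length (35/36)ᵗ.
Squeezed : Weight → Weight → ℕ → Set
Squeezed f g t = ∃[ A ] ∃[ G ] ∃[ N ]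
  (A + G + 35 ^ t ≡ 36 ^ t × DensityAtLeast f A (36 ^ t) N × DensityAtLeast g G (36 ^ t) N)

-- The two counts in a recurring block add up to its area, so the same blocks recur for `g`. A block
-- poor in `f` thus becomes a block rich in `g`.
recurs-complement : ∀ {f g k ℓ m} → Complementary f g → Recurs f k ℓ m → Recurs g k ℓ (k * ℓ ∸ m)
recurs-complement {f} {g} {k} {ℓ} compl rec x y with rec x y
... | i , i′ , j , j′ , i+i′ , j+j′ , refl = i , i′ , j , j′ , i+i′ , j+j′ , sym (trans
  (cong (_∸ count f x′ y′ k ℓ) (sym (count-complement {f} {g} compl x′ y′ k ℓ)))
  (m+n∸m≡n (count f x′ y′ k ℓ) (count g x′ y′ k ℓ)))
  where
  x′ = x ℤ.+ + i
  y′ = y ℤ.+ + j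

-- The recurring block has a density on one side of the midpoint of the current interval.
-- Accordingly the bound for `f` or the one for `g` rises by `E / 36D`, which turns the length
-- `E / D` into `35E / 36D`.
squeeze : ∀ {f g} → Complementary f g → Recurrent f → ∀ t → Squeezed f g t
squeeze compl rec zero = 0 , 0 , 0 , refl , (λ x y K L → z≤n) , (λ x y K L → z≤n)
squeeze {f} {g} compl rec (suc t) with squeeze {f} {g} compl rec t
-- The `suc` keeps the block nonempty even if `N` is 0, as it is at the start.
... | A , G , N , total , low , lowᶜ with rec (suc (64 * (36 ^ t * N)))
... | k , ℓ , m , n<k , n<ℓ , recs = cases (≤-total ((2 * A + E) * (k * ℓ)) (2 * (D * m)))
  where
  open ≤-Reasoning
  D = 36 ^ t
  E = 35 ^ t
  -- A common error constant for the bound that is kept, with `N`, and the one that is raised, with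
  -- the half-perimeter of the cell.
  N′ = N + (3 * k + 3 * ℓ)
  instance
    k≢0 : NonZero k
    k≢0 = >-nonZero (≤-trans z<s n<k)
    ℓ≢0 : NonZero ℓ
    ℓ≢0 = >-nonZero (≤-trans z<s n<ℓ)
  1≤E : 1 ≤ E
  1≤E = m^n>0 35 t
  raise : ∀ {h A} → DensityAtLeast h A (36 * D) (3 * k + 3 * ℓ) → DensityAtLeast h A (36 * D) N′
  raise {h} {A} = densityAtLeast-mono {h} {A} {36 * D} {3 * k + 3 * ℓ} (m≤n+m _ N)
  keep : ∀ {h A} → DensityAtLeast h A D N → DensityAtLeast h (36 * A) (36 * D) N′
  keep {h} {A} d = densityAtLeast-mono {h} {36 * A} {36 * D} {N} (m≤m+n N _)
    (densityAtLeast-scale {h} {A} {D} {N} 36 d)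
  total₁ : ∀ A G E → (36 * A + E) + 36 * G + 35 * E ≡ 36 * (A + G + E)
  total₁ = solve-∀
  total₂ : ∀ A G E → 36 * A + (36 * G + E) + 35 * E ≡ 36 * (A + G + E)
  total₂ = solve-∀
  rest₁ : ∀ A G E → A + E + G ≡ A + G + E
  rest₁ = solve-∀
  rest₂ : ∀ A G E → G + E + A ≡ A + G + E
  rest₂ = solve-∀
  twice : ∀ A G E X → (2 * G + E) * X + (2 * A + E) * X ≡ 2 * ((A + G + E) * X)
  twice = solve-∀
  distrib : ∀ D m m′ → 2 * (D * (m′ + m)) ≡ 2 * (D * m′) + 2 * (D * m)
  distrib = solve-∀
  -- Makes the truncated subtraction in `k * ℓ ∸ m` exact; it is read off the recurring block in the
  -- cell at the origin.
  m≤kℓ : m ≤ k * ℓ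
  m≤kℓ with recs (+ 0) (+ 0)
  ... | i , _ , j , _ , _ , _ , refl =
    ≤-trans (m≤m+n _ _) (≤-reflexive (count-complement {f} {g} compl (+ i) (+ j) k ℓ))
  cases : (2 * A + E) * (k * ℓ) ≤ 2 * (D * m) ⊎ 2 * (D * m) ≤ (2 * A + E) * (k * ℓ) →
    Squeezed f g (suc t)
  cases (inj₁ large) = 36 * A + E , 36 * G , N′ , trans (total₁ A G E) (cong (36 *_) total) ,
    raise {f} {36 * A + E} (densityAtLeast-improve {f} {A} {D} {E} {N} 1≤E
      (≤-trans (m≤m+n (A + E) G) (≤-reflexive (trans (rest₁ A G E) total)))
      (<⇒≤ n<k) (<⇒≤ n<ℓ) low recs large) ,
    keep {g} {G} lowᶜ
  cases (inj₂ small) = 36 * A , 36 * G + E , N′ , trans (total₂ A G E) (cong (36 *_) total) ,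
    keep {f} {A} low ,
    raise {g} {36 * G + E} (densityAtLeast-improve {g} {G} {D} {E} {N} 1≤E
      (≤-trans (m≤m+n (G + E) A) (≤-reflexive (trans (rest₂ A G E) total)))
      (<⇒≤ n<k) (<⇒≤ n<ℓ) lowᶜ (recurs-complement {f} {g} {k} {ℓ} compl recs) largeᶜ)
    where
    -- As `A + G + E` equals `D`, the midpoint for `g` is the complement of the midpoint for `f`.
    largeᶜ : (2 * G + E) * (k * ℓ) ≤ 2 * (D * (k * ℓ ∸ m))
    largeᶜ = +-cancelʳ-≤ (2 * (D * m)) _ _ (begin
      (2 * G + E) * (k * ℓ) + 2 * (D * m)               ≤⟨ +-monoʳ-≤ ((2 * G + E) * (k * ℓ)) small ⟩
      (2 * G + E) * (k * ℓ) + (2 * A + E) * (k * ℓ)     ≡⟨ twice A G E (k * ℓ) ⟩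
      2 * ((A + G + E) * (k * ℓ))                       ≡⟨ cong (λ z → 2 * (z * (k * ℓ))) total ⟩
      2 * (D * (k * ℓ))                                 ≡⟨ cong (λ z → 2 * (D * z)) (m∸n+n≡m m≤kℓ) ⟨
      2 * (D * (k * ℓ ∸ m + m))                         ≡⟨ distrib D m (k * ℓ ∸ m) ⟩
      2 * (D * (k * ℓ ∸ m)) + 2 * (D * m)               ∎)

-- Occurrences in a coverable picture

indicator : ∀ {p} {P : Set p} → Dec P → ℕ
indicator P? = if does P? then 1 else 0

indicator-⇔ : ∀ {p q} {P : Set p} {Q : Set q} → P ⇔ Q →
  (P? : Dec P) (Q? : Dec Q) → indicator P? ≡ indicator Q?
indicator-⇔ P⇔Q P? Q? = cong (if_then 1 else 0) (does-⇔ P⇔Q P? Q?)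

indicator≤1 : ∀ {p} {P : Set p} (P? : Dec P) → indicator P? ≤ 1
indicator≤1 (true  because _) = ≤-refl
indicator≤1 (false because _) = z≤n

indicator-false : ∀ {p} {P : Set p} (P? : Dec P) → (P → ⊥) → indicator P? ≡ 0
indicator-false P? ¬P = cong (if_then 1 else 0) (dec-false P? ¬P)

-- `applyUpTo` recurses on `h ∘ suc`, so the induction needs an arbitrary `h`, although only the
-- identity behind `upTo` is wanted. The same goes for `g` in the next lemma.
length-filter-map : ∀ {a p} {A : Set a} {P : Pred A p} (P? : Decidable P)
  (g : ℕ → A) (h : ℕ → ℕ) n →
  length (filter P? (map g (applyUpTo h n))) ≡ sumBelow (λ j → indicator (P? (g (h j)))) n
length-filter-map P? g h zero = refl
length-filter-map P? g h (suc n) with P? (g (h 0))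
... | true  because _ = cong suc (length-filter-map P? g (h ∘ suc) n)
... | false because _ = length-filter-map P? g (h ∘ suc) n

length-filter-cartesianProduct : ∀ {p} {P : Pred (ℕ × ℕ) p} (P? : Decidable P) (g h : ℕ → ℕ) m n →
  length (filter P? (cartesianProduct (applyUpTo g m) (applyUpTo h n))) ≡
    sumBelow (λ i → sumBelow (λ j → indicator (P? (g i , h j))) n) m
length-filter-cartesianProduct P? g h zero    n = refl
length-filter-cartesianProduct P? g h (suc m) n = begin
  length (filter P? (row ++ rows))                   ≡⟨ cong length (filter-++ P? row rows) ⟩
  length (filter P? row ++ filter P? rows)           ≡⟨ length-++ (filter P? row) ⟩
  length (filter P? row) + length (filter P? rows)
    ≡⟨ cong₂ _+_ (length-filter-map P? (g 0 ,_) h n)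
         (length-filter-cartesianProduct P? (g ∘ suc) h m n) ⟩
  _                                                  ∎
  where
  open ≡-Reasoning
  row = map (g 0 ,_) (applyUpTo h n)
  rows = cartesianProduct (applyUpTo (g ∘ suc) m) (applyUpTo h n)

-- An occurrence is recorded at its corner, so a count over a rectangle includes occurrences that
-- stick out of it. To keep `u` inside, the corners must range over a smaller rectangle.
occurrence : ∀ {s a b} → Block s a b → Picture s → Weight
occurrence {a = a} {b} u w x y = indicator (u ≗? restrict w (x , y) a b)

nonOccurrence : ∀ {s a b} → Block s a b → Picture s → Weight
nonOccurrence u w x y = 1 ∸ occurrence u w x y

occurrence-complementary : ∀ {s a b} (u : Block s a b) w →
  Complementary (occurrence u w) (nonOccurrence u w)
occurrence-complementary {a = a} {b} u w x y =
  m+[n∸m]≡n (indicator≤1 (u ≗? restrict w (x , y) a b))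

restrict-shift : ∀ {s a b k ℓ} (w : Picture s) x y i j (i+a≤k : i + a ≤ k) (j+b≤ℓ : j + b ≤ ℓ) →
  restrict w (x ℤ.+ + i , y ℤ.+ + j) a b ≗ subBlock (restrict w (x , y) k ℓ) i j i+a≤k j+b≤ℓ
restrict-shift w x y i j i+a≤k j+b≤ℓ (i′ , j′) =
  cong₂ (λ x′ y′ → w (x′ , y′)) (eq x i i′ i+a≤k) (eq y j j′ j+b≤ℓ)
  where
  eq : ∀ {a k} x i i′ (i+a≤k : i + a ≤ k) →
    (x ℤ.+ + i) ℤ.+ + toℕ i′ ≡ x ℤ.+ + toℕ (inject≤ (i ↑ʳ i′) i+a≤k)
  eq x i i′ i+a≤k = trans (+-assoc-pos x i (toℕ i′)) (cong (λ m → x ℤ.+ + m)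
    (sym (trans (Fin.toℕ-inject≤ (i ↑ʳ i′) i+a≤k) (Fin.toℕ-↑ʳ i i′))))

-- Where `u` fits inside an occurrence of `q`, the letters that decide whether it occurs all belong
-- to `q`.
occurrence-subBlock : ∀ {s a b k ℓ} (u : Block s a b) w (q : Block s k ℓ) x y →
  OccursAt q w (x , y) → ∀ i j (i+a≤k : i + a ≤ k) (j+b≤ℓ : j + b ≤ ℓ) →
  occurrence u w (x ℤ.+ + i) (y ℤ.+ + j) ≡ indicator (u ≗? subBlock q i j i+a≤k j+b≤ℓ)
occurrence-subBlock u w q x y q≗ i j i+a≤k j+b≤ℓ = indicator-⇔
  (mk⇔ (λ u≗ z → trans (u≗ z) (same z)) (λ u≗ z → trans (u≗ z) (sym (same z))))
  (u ≗? restrict w (x ℤ.+ + i , y ℤ.+ + j) _ _) (u ≗? subBlock q i j i+a≤k j+b≤ℓ)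
  where
  same : restrict w (x ℤ.+ + i , y ℤ.+ + j) _ _ ≗ subBlock q i j i+a≤k j+b≤ℓ
  same z = trans (restrict-shift w x y i j i+a≤k j+b≤ℓ z) (sym (q≗ _))

indicator-occursInAt : ∀ {s a b k ℓ} (u : Block s a b) (w : Picture s) x y i j →
  i + a ≤ k → j + b ≤ ℓ →
  indicator (occursInAt? u (restrict w (x , y) k ℓ) (i , j)) ≡
    occurrence u w (x ℤ.+ + i) (y ℤ.+ + j)
indicator-occursInAt {k = k} {ℓ} u w x y i j i+a≤k j+b≤ℓ = trans
  (indicator-⇔ (mk⇔ (λ (_ , _ , u≗) → u≗) (λ u≗ → i+a≤k , j+b≤ℓ , u≗)) (occursInAt? u v (i , j))
    (u ≗? subBlock v i j i+a≤k j+b≤ℓ))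
  (sym (occurrence-subBlock u w v x y (λ _ → refl) i j i+a≤k j+b≤ℓ))
  where v = restrict w (x , y) k ℓ

-- Of the `suc k` columns of corners that `occurrences` scans, `u` fits at the first `K` and sticks
-- out at the other `a`, which contribute nothing; likewise for the rows.
occurrences-count : ∀ {s a b k ℓ K L} (u : Block s a b) (w : Picture s) x y →
  K + a ≡ suc k → L + b ≡ suc ℓ →
  occurrences u (restrict w (x , y) k ℓ) ≡ count (occurrence u w) x y K L
occurrences-count {a = a} {b} {k} {ℓ} {K} {L} u w x y K+a L+b = begin
  occurrences u v
    ≡⟨ length-filter-cartesianProduct (occursInAt? u v) (λ i → i) (λ j → j) (suc k) (suc ℓ) ⟩
  sumBelow (λ i → sumBelow (hit i) (suc ℓ)) (suc k)
    ≡⟨ cong₂ (λ m n → sumBelow (λ i → sumBelow (hit i) n) m) (sym K+a) (sym L+b) ⟩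
  sumBelow (λ i → sumBelow (hit i) (L + b)) (K + a)
    ≡⟨ sumBelow-truncate _ K a (λ i → sumBelow-zero (L + b) (λ j →
         indicator-false (occursInAt? u v (K + i , j)) (λ (le , _) → outside K a i K+a le))) ⟩
  sumBelow (λ i → sumBelow (hit i) (L + b)) K
    ≡⟨ sumBelow-cong K (λ i _ → sumBelow-truncate (hit i) L b (λ j →
         indicator-false (occursInAt? u v (i , L + j)) (λ (_ , le , _) → outside L b j L+b le))) ⟩
  sumBelow (λ i → sumBelow (hit i) L) K
    ≡⟨ sumBelow-cong K (λ i i<K → sumBelow-cong L (λ j j<L →
         indicator-occursInAt u w x y i j (inside i K a K+a i<K) (inside j L b L+b j<L))) ⟩
  count (occurrence u w) x y K L ∎
  where
  open ≡-Reasoning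
  v = restrict w (x , y) k ℓ
  hit : ℕ → ℕ → ℕ
  hit i j = indicator (occursInAt? u v (i , j))
  inside : ∀ i K a {k} → K + a ≡ suc k → i < K → i + a ≤ k
  inside i K a e i<K = s≤s⁻¹ (≤-trans (+-monoˡ-≤ a i<K) (≤-reflexive e))
  outside : ∀ K a i {k} → K + a ≡ suc k → (K + i) + a ≤ k → ⊥
  outside K a i e le = <-irrefl refl (≤-trans (≤-reflexive (sym e))
    (≤-trans (+-monoˡ-≤ a (m≤m+n K i)) le))

-- The point `x + 2 * k` lies at `c` or to its right, by less than `K ≤ 2 * k`. Hence `c` is between
-- `x` and `x + 2 * k`, and a block of width `k` starting at `c` stays within the cell of width
-- `3 * k` starting at `x`.
offset : ∀ {x c : ℤ} {K k} → K ≤ 2 * k → c ℤ.≤ x ℤ.+ + (2 * k) → x ℤ.+ + (2 * k) ℤ.< c ℤ.+ + K →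
  ∃[ i ] ∃[ i′ ] (i + i′ ≡ 2 * k × x ℤ.+ + i ≡ c)
offset {x} {c} {K} {k} K≤2k c≤p p<c+K = i , 2 * k ∸ i , m+[n∸m]≡n i≤2k , x+i≡c
  where
  x≤c : x ℤ.≤ c
  x≤c = ℤ.≮⇒≥ λ c<x → ℤ.<-asym (ℤ.+-monoˡ-< (+ (2 * k)) c<x)
    (ℤ.<-≤-trans p<c+K (ℤ.+-monoʳ-≤ c (ℤ.+≤+ K≤2k)))
  i = ℤ.∣ c ℤ.- x ∣
  x+i≡c : x ℤ.+ + i ≡ c
  x+i≡c = trans (cong (λ d → x ℤ.+ d) (ℤ.0≤i⇒+∣i∣≡i (ℤ.i≤j⇒0≤j-i x≤c)))
    (trans (ℤ.+-comm x (c ℤ.- x)) (trans (ℤ.+-assoc c (ℤ.- x) x)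
      (trans (cong (λ d → c ℤ.+ d) (ℤ.+-inverseˡ x)) (ℤ.+-identityʳ c))))
  i≤2k : i ≤ 2 * k
  i≤2k = ≮⇒≥ λ 2k<i → ℤ.<⇒≱ (ℤ.+-monoʳ-< x (ℤ.+<+ 2k<i)) (subst (ℤ._≤ _) (sym x+i≡c) c≤p)

-- The occurrence of the cover q through the centre of a cell has its corner
-- in the cell; cutting a columns and b rows off q leaves a block on which
-- the occurrences of u depend on q only.
coverable⇒recurrent : ∀ {s a b} (u : Block s a b) (w : Picture s) →
  MultiScaleCoverable w → Recurrent (occurrence u w)
-- With sides at least `n + 2 * a` and `n + 2 * b`, the cut leaves sides of at least `n` that are
-- also at least half of the original ones, as `offset` requires.
coverable⇒recurrent {a = a} {b} u w coverable n with coverable (n + (2 * a + 2 * b))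
... | K , L , n≤K , n≤L , q , cover =
  k , ℓ , m , n≤k , n≤ℓ , λ x y → recurs x y (cover (x ℤ.+ + (2 * k) , y ℤ.+ + (2 * ℓ)))
  where
  k = K ∸ a
  ℓ = L ∸ b
  f = occurrence u w
  -- Any occurrence of `q` can serve to define `m`; the cover supplies one through the origin.
  origin = cover (+ 0 , + 0)
  x₀ = proj₁ (proj₁ origin)
  y₀ = proj₂ (proj₁ origin)
  m = count f x₀ y₀ k ℓ
  long : ∀ a c K → n + c ≤ K → 2 * a ≤ c → (n ≤ K ∸ a) × (K ≤ 2 * (K ∸ a)) × (K ∸ a + a ≡ K)
  long a c K n+c≤K 2a≤c =
    ≤-trans (m≤m+n n a) n+a≤ ,
    ≤-trans (≤-reflexive (sym K≡)) (+-monoʳ-≤ (K ∸ a) (≤-trans a≤ (m≤m+n (K ∸ a) 0))) ,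
    K≡
    where
    n+2a≤K : n + a + a ≤ K
    n+2a≤K = ≤-trans (≤-reflexive
      (trans (+-assoc n a a) (cong (λ z → n + (a + z)) (sym (+-identityʳ a)))))
      (≤-trans (+-monoʳ-≤ n 2a≤c) n+c≤K)
    n+a≤ : n + a ≤ K ∸ a
    n+a≤ = m+n≤o⇒m≤o∸n (n + a) n+2a≤K
    a≤ : a ≤ K ∸ a
    a≤ = ≤-trans (m≤n+m a n) n+a≤
    K≡ : K ∸ a + a ≡ K
    K≡ = m∸n+n≡m (≤-trans (m≤n+m a (n + a)) n+2a≤K)
  longˣ = long a _ K n≤K (m≤m+n (2 * a) (2 * b))
  longʸ = long b _ L n≤L (m≤n+m (2 * b) (2 * a))
  n≤k = proj₁ longˣ
  n≤ℓ = proj₁ longʸ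
  inside : ∀ {i k K a} → k + a ≡ K → i < k → i + a ≤ K
  inside {a = a} e i<k = ≤-trans (+-monoˡ-≤ a (<⇒≤ i<k)) (≤-reflexive e)
  fixed : ∀ x y x′ y′ → OccursAt q w (x , y) → OccursAt q w (x′ , y′) →
    count f x y k ℓ ≡ count f x′ y′ k ℓ
  fixed x y x′ y′ q≗ q≗′ = sumBelow-cong k λ i i<k → sumBelow-cong ℓ λ j j<ℓ →
    let i+a≤K = inside (proj₂ (proj₂ longˣ)) i<k
        j+b≤L = inside (proj₂ (proj₂ longʸ)) j<ℓ
    in trans (occurrence-subBlock u w q x y q≗ i j i+a≤K j+b≤L)
         (sym (occurrence-subBlock u w q x′ y′ q≗′ i j i+a≤K j+b≤L))
  recurs : ∀ x y → ∃[ c ] (OccursAt q w c × InRectangle c K L (x ℤ.+ + (2 * k) , y ℤ.+ + (2 * ℓ))) →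
    ∃[ i ] ∃[ i′ ] ∃[ j ] ∃[ j′ ]
      (i + i′ ≡ 2 * k × j + j′ ≡ 2 * ℓ × count f (x ℤ.+ + i) (y ℤ.+ + j) k ℓ ≡ m)
  recurs x y ((cx , cy) , q≗ , (cx≤ , <cx) , (cy≤ , <cy))
    with offset {x} {k = k} (proj₁ (proj₂ longˣ)) cx≤ <cx
       | offset {y} {k = ℓ} (proj₁ (proj₂ longʸ)) cy≤ <cy
  ... | i , i′ , i+i′ , refl | j , j′ , j+j′ , refl =
    i , i′ , j , j′ , i+i′ , j+j′ , fixed (x ℤ.+ + i) (y ℤ.+ + j) x₀ y₀ q≗ (proj₁ (proj₂ origin))

-- Convergence

-- Bernoulli's inequality for `1 + 1/b`, multiplied by `b ^ suc t` to stay within the natural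
-- numbers.
bernoulli : ∀ b t → b ^ t * (b + t) ≤ b * suc b ^ t
bernoulli b zero    = ≤-reflexive (e b)
  where
  e : ∀ b → 1 * (b + 0) ≡ b * 1
  e = solve-∀
bernoulli b (suc t) = begin
  b * b ^ t * (b + suc t)                    ≤⟨ m≤m+n _ (b ^ t * t) ⟩
  b * b ^ t * (b + suc t) + b ^ t * t        ≡⟨ e₁ b (b ^ t) t ⟩
  suc b * (b ^ t * (b + t))                  ≤⟨ *-monoʳ-≤ (suc b) (bernoulli b t) ⟩
  suc b * (b * suc b ^ t)                    ≡⟨ e₂ b (suc b) (suc b ^ t) ⟩
  b * (suc b * suc b ^ t)                    ∎
  where
  open ≤-Reasoning
  e₁ : ∀ b p t → b * p * (b + (1 + t)) + p * t ≡ (1 + b) * (p * (b + t))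
  e₁ = solve-∀
  e₂ : ∀ b c q → c * (b * q) ≡ b * (c * q)
  e₂ = solve-∀

-- By Bernoulli's inequality the quotient of the two powers is at least `1 + t / b`, which exceeds
-- `c` for `t = b * c`. With `b = 35` this makes the squeezed interval as short as desired.
powers-separate : ∀ b .{{_ : NonZero b}} c → ∃[ t ] (c * b ^ t ≤ suc b ^ t)
powers-separate b c = t , *-cancelˡ-≤ b (begin
  b * (c * b ^ t)    ≡⟨ e b c (b ^ t) ⟩
  b ^ t * t          ≤⟨ *-monoʳ-≤ (b ^ t) (m≤n+m t b) ⟩
  b ^ t * (b + t)    ≤⟨ bernoulli b t ⟩
  b * suc b ^ t      ∎)
  where
  open ≤-Reasoning
  t = b * c
  e : ∀ b c p → b * (c * p) ≡ p * (b * c)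
  e = solve-∀

-- Rational inequalities and Cauchy sequences

toℚᵘ-/ : ∀ n d → ℚ.toℚᵘ (+ n ℚ./ suc d) ℚᵘ.≃ mkℚᵘ (+ n) d
toℚᵘ-/ n d = ℚ.toℚᵘ-fromℚᵘ (mkℚᵘ (+ n) d)

-- Since `_/_` reduces to lowest terms, the comparison passes to unnormalised rationals, where
-- cross-multiplication yields the hypothesis.
/-≤-+ : ∀ m n m′ n′ j .{{_ : NonZero n}} .{{_ : NonZero n′}} →
  m * (n′ * suc j) ≤ (m′ * suc j + n′) * n →
  + m ℚ./ n ℚ.≤ (+ m′ ℚ./ n′) ℚ.+ (+ 1 ℚ./ suc j)
/-≤-+ m (suc n) m′ (suc n′) j le = ℚ.toℚᵘ-cancel-≤ (begin
  ℚ.toℚᵘ (+ m ℚ./ suc n)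
    ≃⟨ toℚᵘ-/ m n ⟩
  mkℚᵘ (+ m) n
    ≤⟨ ℚᵘ.*≤* (subst₂ ℤ._≤_ (ℤ.pos-* m _)
         (trans (ℤ.pos-* (m′ * suc j + suc n′) (suc n))
           (cong (λ z → z ℤ.* + suc n) numerator)) (ℤ.+≤+ le)) ⟩
  mkℚᵘ (+ m′) n′ ℚᵘ.+ mkℚᵘ (+ 1) j
    ≃⟨ ℚᵘ.+-cong (toℚᵘ-/ m′ n′) (toℚᵘ-/ 1 j) ⟨
  ℚ.toℚᵘ (+ m′ ℚ./ suc n′) ℚᵘ.+ ℚ.toℚᵘ (+ 1 ℚ./ suc j)
    ≃⟨ ℚ.toℚᵘ-homo-+ (+ m′ ℚ./ suc n′) (+ 1 ℚ./ suc j) ⟨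
  ℚ.toℚᵘ ((+ m′ ℚ./ suc n′) ℚ.+ (+ 1 ℚ./ suc j)) ∎)
  where
  open ℚᵘ.≤-Reasoning
  numerator : + (m′ * suc j + suc n′) ≡ + m′ ℤ.* + suc j ℤ.+ + 1 ℤ.* + suc n′
  numerator = trans (ℤ.pos-+ (m′ * suc j) (suc n′))
    (cong₂ ℤ._+_ (ℤ.pos-* m′ (suc j)) (sym (ℤ.*-identityˡ (+ suc n′))))

p-q≤r : ∀ p q r → p ℚ.≤ q ℚ.+ r → p ℚ.- q ℚ.≤ r
p-q≤r p q r p≤q+r = begin
  p ℚ.- q          ≤⟨ ℚ.+-monoˡ-≤ (ℚ.- q) p≤q+r ⟩
  q ℚ.+ r ℚ.- q    ≡⟨ cong (ℚ._- q) (ℚ.+-comm q r) ⟩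
  r ℚ.+ q ℚ.- q    ≡⟨ //-rightDividesʳ ℚ.+-0-group q r ⟩
  r                ∎
  where open ℚ.≤-Reasoning

∣p-q∣≤r : ∀ {p q r} → p ℚ.≤ q ℚ.+ r → q ℚ.≤ p ℚ.+ r → ℚ.∣ p ℚ.- q ∣ ℚ.≤ r
∣p-q∣≤r {p} {q} {r} p≤ q≤ with ℚ.∣p∣≡p∨∣p∣≡-p (p ℚ.- q)
... | inj₁ e = subst (ℚ._≤ r) (sym e) (p-q≤r p q r p≤)
... | inj₂ e = subst (ℚ._≤ r) (sym (trans e (⁻¹-anti-homo-// ℚ.+-0-group p q))) (p-q≤r q p r q≤)

Cauchy : (ℕ → ℚ) → Set
Cauchy f = ∀ j → ∃[ N ] (∀ m n → m ≥ N → n ≥ N → ℚ.∣ f m ℚ.- f n ∣ ℚ.≤ + 1 ℚ./ suc j)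

0≤1/ : ∀ j → ℚ.0ℚ ℚ.≤ + 1 ℚ./ suc j
0≤1/ j = ℚ.nonNegative⁻¹ (+ 1 ℚ./ suc j) {{ℚ.normalize-nonNeg 1 (suc j)}}

-- A positive rational has numerator at least 1, so the reciprocal of its own denominator does not
-- exceed it.
archimedean : ∀ ε → ℚ.0ℚ ℚ.< ε → ∃[ j ] (+ 1 ℚ./ suc j ℚ.≤ ε)
archimedean (ℚ.mkℚ (+ zero) d c) 0<ε = ⊥-elim (ℤ.<-irrefl refl (ℚ.drop-*<* 0<ε))
archimedean ε@(ℚ.mkℚ (+ suc n) d c) 0<ε = d , ℚ.toℚᵘ-cancel-≤ (begin
  ℚ.toℚᵘ (+ 1 ℚ./ suc d)   ≃⟨ toℚᵘ-/ 1 d ⟩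
  mkℚᵘ (+ 1) d             ≤⟨ ℚᵘ.*≤* (ℤ.*-monoʳ-≤-nonNeg (+ suc d) (ℤ.+≤+ (s≤s (z≤n {n})))) ⟩
  mkℚᵘ (+ suc n) d         ∎)
  where open ℚᵘ.≤-Reasoning
archimedean (ℚ.mkℚ (ℤ.-[1+ n ]) d c) 0<ε with ℚ.drop-*<* 0<ε
... | ()

p≤p+q : ∀ {p q} → ℚ.0ℚ ℚ.≤ q → p ℚ.≤ p ℚ.+ q
p≤p+q {p} {q} 0≤q = subst (ℚ._≤ p ℚ.+ q) (ℚ.+-identityʳ p) (ℚ.+-monoʳ-≤ p 0≤q)

p≤q+p : ∀ {p q} → ℚ.0ℚ ℚ.≤ q → p ℚ.≤ q ℚ.+ p
p≤q+p {p} {q} 0≤q = subst (ℚ._≤ q ℚ.+ p) (ℚ.+-identityˡ p) (ℚ.+-monoˡ-≤ p 0≤q)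

-- The limit is approximated by the terms at the moduli. As these need not increase with the
-- precision, two of them are compared first: both terms in question lie beyond the smaller one and
-- obey its bound.
cauchy⇒convergent : ∀ f → Cauchy f → Σ[ x ∈ ℝ ] ConvergesTo f x
cauchy⇒convergent f cauchy = limit , converges
  where
  N : ℕ → ℕ
  N j = proj₁ (cauchy j)
  close : ∀ j m n → m ≥ N j → n ≥ N j → ℚ.∣ f m ℚ.- f n ∣ ℚ.≤ + 1 ℚ./ suc j
  close j = proj₂ (cauchy j)
  limit : ℝ
  limit .approx j = f (N j)
  limit .regular m n with ≤-total (N m) (N n)
  ... | inj₁ le = ℚ.≤-trans (close m (N m) (N n) ≤-refl le) (p≤p+q (0≤1/ n))
  ... | inj₂ le = ℚ.≤-trans (close n (N m) (N n) le ≤-refl) (p≤q+p (0≤1/ m))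
  converges : ConvergesTo f limit
  converges ε 0<ε with archimedean ε 0<ε
  ... | j , 1/j≤ε = N j , within
    where
    within : ∀ n → n ≥ N j → Within ε (f n) limit
    within n n≥ m with ≤-total (N j) (N m)
    ... | inj₁ le = ℚ.≤-trans (close j n (N m) n≥ le) (ℚ.≤-trans 1/j≤ε (p≤p+q (0≤1/ m)))
    ... | inj₂ le = ℚ.≤-trans (close m n (N m) (≤-trans le n≥) ≤-refl) (p≤q+p (ℚ.<⇒≤ 0<ε))

-- With denominators cleared: `o / T` is at most `(A + 2E) / D` and `o′ / T′` at least
-- `(A - E) / D`, and the difference `3E / D` of these bounds is at most `1 / suc j`.
fractions-close : ∀ {A D E} j o T o′ T′ .{{_ : NonZero D}} → 3 * suc j * E ≤ D →
  D * o ≤ (A + 2 * E) * T → A * T′ ≤ D * o′ + E * T′ →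
  o * (T′ * suc j) ≤ (o′ * suc j + T′) * T
fractions-close {A} {D} {E} j o T o′ T′ small upper lower = *-cancelˡ-≤ D (begin
  D * (o * (T′ * J))
    ≡⟨ e₁ D o T′ J ⟩
  D * o * (T′ * J)
    ≤⟨ *-monoˡ-≤ (T′ * J) upper ⟩
  (A + 2 * E) * T * (T′ * J)
    ≡⟨ e₂ A E T T′ J ⟩
  A * T′ * (T * J) + 2 * E * T′ * (T * J)
    ≤⟨ +-monoˡ-≤ _ (*-monoˡ-≤ (T * J) lower) ⟩
  (D * o′ + E * T′) * (T * J) + 2 * E * T′ * (T * J)
    ≡⟨ e₃ D E o′ T T′ J ⟩
  D * (o′ * (J * T)) + 3 * J * E * (T′ * T)
    ≤⟨ +-monoʳ-≤ (D * (o′ * (J * T))) (*-monoˡ-≤ (T′ * T) small) ⟩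
  D * (o′ * (J * T)) + D * (T′ * T)
    ≡⟨ e₄ D o′ J T T′ ⟩
  D * ((o′ * J + T′) * T) ∎)
  where
  open ≤-Reasoning
  J = suc j
  e₁ : ∀ D o T J → D * (o * (T * J)) ≡ D * o * (T * J)
  e₁ = solve-∀
  e₂ : ∀ A E T T′ J → (A + 2 * E) * T * (T′ * J) ≡ A * T′ * (T * J) + 2 * E * T′ * (T * J)
  e₂ = solve-∀
  e₃ : ∀ D E o T T′ J → (D * o + E * T′) * (T * J) + 2 * E * T′ * (T * J) ≡
    D * (o * (J * T)) + 3 * J * E * (T′ * T)
  e₃ = solve-∀
  e₄ : ∀ D o J T T′ → D * (o * (J * T)) + D * (T′ * T) ≡ D * ((o * J + T′) * T)
  e₄ = solve-∀

-- Frequencies in the central blocks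

module _ {s a b} (u : Block s a b) (w : Picture s) where

  private
    size : ℕ → ℕ
    size n = suc (2 * n)

    hits : ℕ → ℕ
    hits n = occurrences u (centralBlock n w)

    -- The squeezed interval from `A / D` to `(A + E) / D`, widened by `E / D` on both sides to
    -- absorb the boundary effects.
    FrequencyBounds : ℕ → ℕ → ℕ → ℕ → Set
    FrequencyBounds A D E n =
      A * (size n * size n) ≤ D * hits n + E * (size n * size n) ×
      D * hits n ≤ (A + 2 * E) * (size n * size n)

  -- Boundary effects are linear in the side `S` of the central block and its area is quadratic, so
  -- that from `n ≥ D * c` on they amount to at most `E * (S * S)`.
  squeezed⇒bounds : ∀ t → Squeezed (occurrence u w) (nonOccurrence u w) t →
    ∃[ A ] ∃[ M ] (∀ n → n ≥ M → FrequencyBounds A (36 ^ t) (35 ^ t) n)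
  squeezed⇒bounds t (A , G , N , total , low , lowᶜ) = A , D * c , λ n n≥ → lower n n≥ , upper n n≥
    where
    open ≤-Reasoning
    D = 36 ^ t
    E = 35 ^ t
    -- `2 * N` stands for the perimeter error, `a + b` for the corners at the edge where `u` does
    -- not fit, and `2` for the passage between `S * S` and `suc S * suc S`. Both bounds share this
    -- constant.
    c = 2 * N + (a + b) + 2
    1≤E : 1 ≤ E
    1≤E = m^n>0 35 t
    A+E≤D : A + E ≤ D
    A+E≤D = ≤-trans (m≤m+n (A + E) G) (≤-reflexive (trans (e A G E) total))
      where
      e : ∀ A G E → A + E + G ≡ A + G + E
      e = solve-∀
    c≤Dc : c ≤ D * c
    c≤Dc = m≤n*m c D {{m^n≢0 36 t}}

    module _ (n : ℕ) (n≥ : n ≥ D * c) where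
      S = size n
      n≤S : n ≤ suc S
      n≤S = ≤-trans (m≤m+n n _) (≤-trans (n≤1+n _) (n≤1+n _))
      a+b≤c : a + b ≤ c
      a+b≤c = ≤-trans (m≤n+m (a + b) (2 * N)) (m≤m+n _ 2)
      a≤S : a ≤ suc S
      a≤S = ≤-trans (≤-trans (m≤m+n a b) a+b≤c) (≤-trans c≤Dc (≤-trans n≥ n≤S))
      b≤S : b ≤ suc S
      b≤S = ≤-trans (≤-trans (m≤n+m b a) a+b≤c) (≤-trans c≤Dc (≤-trans n≥ n≤S))
      K = suc S ∸ a
      L = suc S ∸ b
      K+a : K + a ≡ suc S
      K+a = m∸n+n≡m a≤S
      L+b : L + b ≡ suc S
      L+b = m∸n+n≡m b≤S
      K≤ : K ≤ suc S
      K≤ = m∸n≤m (suc S) a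
      L≤ : L ≤ suc S
      L≤ = m∸n≤m (suc S) b
      corner = ℤ.- (+ n)
      C = count (occurrence u w) corner corner K L
      Cᶜ = count (nonOccurrence u w) corner corner K L
      hits≡C : hits n ≡ C
      hits≡C = occurrences-count u w corner corner K+a L+b
      C+Cᶜ : C + Cᶜ ≡ K * L
      C+Cᶜ = count-complement {occurrence u w} {nonOccurrence u w}
        (occurrence-complementary u w) corner corner K L
      K+L≤ : K + L ≤ 2 * suc S
      K+L≤ = ≤-trans (+-mono-≤ K≤ L≤)
        (≤-reflexive (cong (λ z → suc S + z) (sym (+-identityʳ (suc S)))))
      slack : D * (c * suc S) ≤ E * (S * S)
      slack = begin
        D * (c * suc S)
          ≡⟨ *-assoc D c (suc S) ⟨
        D * c * suc S
          ≤⟨ *-monoˡ-≤ (suc S) n≥ ⟩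
        n * suc S
          ≤⟨ m≤m+n _ (2 * (n * n) + 2 * n + 1) ⟩
        n * suc S + (2 * (n * n) + 2 * n + 1)
          ≡⟨ e n ⟩
        S * S
          ≤⟨ ≤-trans (≤-reflexive (sym (*-identityˡ (S * S)))) (*-monoˡ-≤ (S * S) 1≤E) ⟩
        E * (S * S) ∎
        where
        e : ∀ n → n * (2 + 2 * n) + (2 * (n * n) + 2 * n + 1) ≡ (1 + 2 * n) * (1 + 2 * n)
        e = solve-∀
      lower : A * (S * S) ≤ D * hits n + E * (S * S)
      lower = begin
        A * (S * S)
          ≤⟨ *-monoʳ-≤ A (*-mono-≤ (n≤1+n S) (n≤1+n S)) ⟩
        A * (suc S * suc S)
          ≡⟨ cong (A *_) (cong₂ _*_ (sym K+a) (sym L+b)) ⟩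
        A * ((K + a) * (L + b))
          ≡⟨ e₁ A K a L b ⟩
        A * (K * L) + A * ((K + a) * b + a * L)
          ≤⟨ +-mono-≤ (low corner corner K L) (*-mono-≤ (≤-trans (m≤m+n A E) A+E≤D)
               (+-mono-≤ (≤-reflexive (cong (_* b) K+a)) (*-monoʳ-≤ a L≤))) ⟩
        D * (C + N * (K + L)) + D * (suc S * b + a * suc S)
          ≤⟨ +-monoˡ-≤ _ (*-monoʳ-≤ D (+-monoʳ-≤ C (*-monoʳ-≤ N K+L≤))) ⟩
        D * (C + N * (2 * suc S)) + D * (suc S * b + a * suc S)
          ≤⟨ m≤m+n _ (D * (2 * suc S)) ⟩
        D * (C + N * (2 * suc S)) + D * (suc S * b + a * suc S) + D * (2 * suc S)
          ≡⟨ e₂ D C N a b (suc S) ⟩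
        D * C + D * (c * suc S)
          ≤⟨ +-monoʳ-≤ (D * C) slack ⟩
        D * C + E * (S * S)
          ≡⟨ cong (λ z → D * z + E * (S * S)) hits≡C ⟨
        D * hits n + E * (S * S) ∎
        where
        e₁ : ∀ A K a L b → A * ((K + a) * (L + b)) ≡ A * (K * L) + A * ((K + a) * b + a * L)
        e₁ = solve-∀
        e₂ : ∀ D C N a b S → D * (C + N * (2 * S)) + D * (S * b + a * S) + D * (2 * S) ≡
          D * C + D * ((2 * N + (a + b) + 2) * S)
        e₂ = solve-∀
      upper : D * hits n ≤ (A + 2 * E) * (S * S)
      -- A lower bound for the non-occurrences among the `K * L` corners is an upper bound for the
      -- occurrences; adding `D * Cᶜ` on both sides avoids subtraction.
      upper = +-cancelʳ-≤ (D * Cᶜ) _ _ (begin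
        D * hits n + D * Cᶜ
          ≡⟨ cong (λ z → D * z + D * Cᶜ) hits≡C ⟩
        D * C + D * Cᶜ
          ≡⟨ *-distribˡ-+ D C Cᶜ ⟨
        D * (C + Cᶜ)
          ≡⟨ cong₂ _*_ (sym total) C+Cᶜ ⟩
        (A + G + E) * (K * L)
          ≡⟨ e₁ A G E (K * L) ⟩
        (A + E) * (K * L) + G * (K * L)
          ≤⟨ +-mono-≤ (*-monoʳ-≤ (A + E) (*-mono-≤ K≤ L≤)) (lowᶜ corner corner K L) ⟩
        (A + E) * (suc S * suc S) + D * (Cᶜ + N * (K + L))
          ≤⟨ +-monoʳ-≤ _ (*-monoʳ-≤ D (+-monoʳ-≤ Cᶜ (*-monoʳ-≤ N K+L≤))) ⟩
        (A + E) * (suc S * suc S) + D * (Cᶜ + N * (2 * suc S))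
          ≡⟨ cong (λ z → z + D * (Cᶜ + N * (2 * suc S))) (e₂ (A + E) S) ⟩
        (A + E) * (S * S) + (A + E) * (S + suc S) + D * (Cᶜ + N * (2 * suc S))
          ≤⟨ +-monoˡ-≤ _ (+-monoʳ-≤ ((A + E) * (S * S))
               (*-mono-≤ A+E≤D (+-monoˡ-≤ (suc S) (n≤1+n S)))) ⟩
        (A + E) * (S * S) + D * (suc S + suc S) + D * (Cᶜ + N * (2 * suc S))
          ≤⟨ m≤m+n _ (D * ((a + b) * suc S)) ⟩
        (A + E) * (S * S) + D * (suc S + suc S) + D * (Cᶜ + N * (2 * suc S)) + D * ((a + b) * suc S)
          ≡⟨ e₃ ((A + E) * (S * S)) D Cᶜ N a b (suc S) ⟩
        (A + E) * (S * S) + D * (c * suc S) + D * Cᶜ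
          ≤⟨ +-monoˡ-≤ (D * Cᶜ) (+-monoʳ-≤ ((A + E) * (S * S)) slack) ⟩
        (A + E) * (S * S) + E * (S * S) + D * Cᶜ
          ≡⟨ cong (_+ D * Cᶜ) (e₄ A E (S * S)) ⟩
        (A + 2 * E) * (S * S) + D * Cᶜ ∎)
        where
        e₁ : ∀ A G E X → (A + G + E) * X ≡ (A + E) * X + G * X
        e₁ = solve-∀
        e₂ : ∀ B S → B * ((1 + S) * (1 + S)) ≡ B * (S * S) + B * (S + (1 + S))
        e₂ = solve-∀
        e₃ : ∀ X D C N a b S → X + D * (S + S) + D * (C + N * (2 * S)) + D * ((a + b) * S) ≡
          X + D * ((2 * N + (a + b) + 2) * S) + D * C
        e₃ = solve-∀
        e₄ : ∀ A E X → (A + E) * X + E * X ≡ (A + 2 * E) * X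
        e₄ = solve-∀

  frequency-close : ∀ {A D E} .{{_ : NonZero D}} j → 3 * suc j * E ≤ D →
    ∀ m n → FrequencyBounds A D E m → FrequencyBounds A D E n →
    frequency u (centralBlock m w) ℚ.≤ frequency u (centralBlock n w) ℚ.+ (+ 1 ℚ./ suc j)
  frequency-close {A} {D} {E} j small m n (_ , upper) (lower , _) =
    /-≤-+ (hits m) (size m * size m) (hits n) (size n * size n) j
      {{m*n≢0 (size m) (size m)}} {{m*n≢0 (size n) (size n)}}
      (fractions-close {A} {D} {E} j (hits m) (size m * size m) (hits n) (size n * size n)
        small upper lower)

  frequency-cauchy : MultiScaleCoverable w → Cauchy (λ n → frequency u (centralBlock n w))
  frequency-cauchy coverable j = M , λ m n m≥ n≥ →
    ∣p-q∣≤r (close m n (bounds m m≥) (bounds n n≥)) (close n m (bounds n n≥) (bounds m m≥))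
    where
    -- Yields a `t` for which three times the interval length `35 ^ t / 36 ^ t` is at most
    -- `1 / suc j`.
    separation = powers-separate 35 (3 * suc j)
    t = proj₁ separation
    squeezed = squeezed⇒bounds t (squeeze {occurrence u w} {nonOccurrence u w}
      (occurrence-complementary u w) (coverable⇒recurrent u w coverable) t)
    M = proj₁ (proj₂ squeezed)
    bounds = proj₂ (proj₂ squeezed)
    close = frequency-close {proj₁ squeezed} {36 ^ t} {35 ^ t} {{m^n≢0 36 t}} j (proj₂ separation)

theorem12 : (s : ℕ) (w : Picture s) → MultiScaleCoverable w → HasUniformFrequencies w
theorem12 s w coverable u _ = cauchy⇒convergent
  (λ n → frequency u (centralBlock n w)) (frequency-cauchy u w coverable)
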